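{- Let $n$ be even and $k$ odd with $\frac{n}{2} \leqslant k < n-3$. Let $h = \frac{n-k-1}{2}$ and $p = \gcd(n,h)$. Then $$\mathrm{LB}(n,k) + \left\lceil \frac{p}{2}\right\rceil - 1 \leqslant rn_k(C_n) \leqslant \mathrm{LB}(n,k) + p - 1,$$ where $\mathrm{LB}(n,k) = \left\lceil \frac{3k+3-n}{2}\right\rceil \cdot \frac{n-2}{2} + k - \frac{n}{2} + 1$. Moreover, if $\frac{n}{2} \notin \langle h \rangle$, where $\langle h\rangle$ is the subgroup of $\mathbb{Z}_n$ generated by $h$, then $rn_k(C_n) = \mathrm{LB}(n,k) + \left\lceil \frac{p}{2}\right\rceil - 1$.
   Context: $C_n$ is the cycle on vertex set $\mathbb{Z}_n$, with $u,v$ adjacent iff $u \equiv v \pm 1 \pmod n$; $d(u,v)$ is the graph distance. A radio-$k$-labeling of a graph $G$ is a function $f \colon V(G) \to \{0,1,2,\ldots\}$ with $|f(u)-f(v)| \geqslant k - d(u,v) + 1$ for all distinct $u,v$. The span of $f$ is $\max\{|f(u)-f(v)|\}$, and $rn_k(G)$ is the minimum span over radio-$k$-labelings of $G$. -}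

module Defs where

open import Data.Nat using (ℕ; zero; suc; _+_; _*_; _∸_; _≤_; _<_; ∣_-_∣; ⌈_/2⌉; _/_; _%_)
open import Data.Nat.GCD using (gcd)
open import Data.Fin using (Fin; toℕ)
open import Data.Product using (Σ; _×_; ∃; ∃-syntax)
open import Data.Sum using (_⊎_)
open import Relation.Binary.PropositionalEquality using (_≡_; _≢_)

-- Cycle C_n on vertex set ℤ_n = Fin n (elements 0..n-1);
-- u ~ v iff u ≡ v ± 1 (mod n), written out without %.
Adj : (n : ℕ) → Fin n → Fin n → Set
Adj n u v =
    (toℕ v ≡ suc (toℕ u))
  ⊎ (toℕ u ≡ suc (toℕ v))
  ⊎ (suc (toℕ u) ≡ n × toℕ v ≡ 0)
  ⊎ (suc (toℕ v) ≡ n × toℕ u ≡ 0)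

data Walk (n : ℕ) : Fin n → Fin n → ℕ → Set where
  [] : ∀ {u} → Walk n u u 0
  _∷_ : ∀ {u v w ℓ} → Adj n u v → Walk n v w ℓ → Walk n u w (suc ℓ)

IsDist : (n : ℕ) → Fin n → Fin n → ℕ → Set
IsDist n u v d = Walk n u v d × (∀ ℓ → Walk n u v ℓ → d ≤ ℓ)

-- Radio-k-labeling: |f u - f v| ≥ k - d(u,v) + 1 for distinct u, v
-- (stated additively, equivalent over ℤ: |f u - f v| + d(u,v) ≥ k + 1).
IsRadioLabeling : (n k : ℕ) → (Fin n → ℕ) → Set
IsRadioLabeling n k f =
  ∀ u v → u ≢ v → ∀ d → IsDist n u v d → k + 1 ≤ ∣ f u - f v ∣ + d

IsSpan : (n : ℕ) → (Fin n → ℕ) → ℕ → Set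
IsSpan n f s = (∀ u v → ∣ f u - f v ∣ ≤ s) × (∃[ u ] ∃[ v ] ∣ f u - f v ∣ ≡ s)

IsRadioNumber : (n k r : ℕ) → Set
IsRadioNumber n k r =
    (∃[ f ] IsRadioLabeling n k f × IsSpan n f r)
  × (∀ f s → IsRadioLabeling n k f → IsSpan n f s → r ≤ s)

-- x ∈ ⟨h⟩ ≤ ℤ_n  (for 0 ≤ x < n): some multiple t·h is congruent to x mod n.
InCyclicSubgroup : (n h x : ℕ) → Set
InCyclicSubgroup n h x = ∃[ t ] ∃[ c ] t * h ≡ x + c * n

LB : ℕ → ℕ → ℕ
LB n k = ⌈ (3 * k + 3 ∸ n) /2⌉ * ((n ∸ 2) / 2) + (k ∸ n / 2) + 1

{-# OPTIONS --safe #-}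
-- Put m = n/2, g = k + 1 − m, φ = (3k + 3 − n)/2, and list the vertices x₀, x₁, … by increasing label.
-- Any three vertices have pairwise distances summing to at most n, so f(xᵢ₊₂) − f(xᵢ) ≥ φ, and
-- equality forces d(xᵢ, xᵢ₊₂) = h, so that xᵢ and xᵢ₊₂ are congruent modulo p.  Together with
-- f(xᵢ₊₁) − f(xᵢ) ≥ g this gives span ≥ LB, and if the span is LB + e then the even-indexed vertices
-- meet at most e + 1 residue classes modulo p, and so do the odd-indexed ones; hence p ≤ 2(e + 1).
--
-- Conversely let q = gcd(h, m) and M = m/q.  The positions aᵢ = i h + ⌊i/M⌋, 0 ≤ i < m, exhaust ℤ_m,
-- so the aᵢ and their antipodes aᵢ + m exhaust ℤ_n.  Labelling aᵢ by i φ + ⌊i/M⌋ and aᵢ + m by g more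
-- is a radio labeling, of span at most LB + q − 1.  Finally q divides p, and q = p would give p ∣ m,
-- i.e. n/2 ∈ ⟨h⟩; so q ≤ ⌈p/2⌉ otherwise.
module Submission where

open import Data.Nat
open import Data.Nat.Properties
open import Data.Nat.Tactic.RingSolver using (solve)
open import Data.List.Base using ([]; _∷_)
open import Relation.Binary.PropositionalEquality

-- Arithmetic

-- The certificate form of a linear inequality: a ≤ b follows from l ≤ r once
-- a + r + w and b + l agree as semiring expressions.
≤-by : ∀ {a b l r} w → l ≤ r → a + r + w ≡ b + l → a ≤ b
≤-by {a} {b} {l} {r} w l≤r eq = +-cancelʳ-≤ r a b (begin
  a + r      ≤⟨ m≤m+n (a + r) w ⟩
  a + r + w  ≡⟨ eq ⟩
  b + l      ≤⟨ +-monoʳ-≤ b l≤r ⟩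
  b + r      ∎)
  where open ≤-Reasoning

+-reverse₃ : ∀ x y z → x + y + z ≡ z + y + x
+-reverse₃ x y z = solve (x ∷ y ∷ z ∷ [])

+-rotateˡ₃ : ∀ x y z → x + y + z ≡ y + z + x
+-rotateˡ₃ x y z = solve (x ∷ y ∷ z ∷ [])

+-swapʳ₃ : ∀ x y z → x + y + z ≡ x + z + y
+-swapʳ₃ x y z = solve (x ∷ y ∷ z ∷ [])

+-rotateʳ₃ : ∀ x y z → x + y + z ≡ z + x + y
+-rotateʳ₃ x y z = solve (x ∷ y ∷ z ∷ [])

-- From here on n = 4h + 2t + 2 and k = 2h + 2t + 1, that is, h = (n − k − 1)/2 and t = k − n/2.
-- Then n/2 = 2h + t + 1, the minimal label gap k + 1 − n/2 is t + 1, and (3(k + 1) − n)/2 = h + 2t + 2.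
module _ (h t : ℕ) where

  -- The hypotheses on `x` and `y` give 2x ≤ n, so a distance `x` absorbs at most n/2 of the
  -- required k + 1 and leaves t + 1 for the labels.
  gap₁-bound : ∀ {A B x y} → x ≤ y → x + y ≤ 4 * h + 2 * t + 2 →
    2 * h + 2 * t + 2 + A ≤ B + x → A + (t + 1) ≤ B
  gap₁-bound {A} {B} {x} {y} x≤y x+y≤n AB = *-cancelˡ-≤ 2
    (≤-by {2 * (A + (t + 1))} {2 * B} 0 (+-mono-≤ x≤y (+-mono-≤ x+y≤n (+-mono-≤ AB AB)))
      (solve (h ∷ t ∷ A ∷ B ∷ x ∷ y ∷ [])))

  -- In the sum of the three radio inequalities `B` cancels, leaving 2A + 3(k + 1) - n ≤ 2C; and 3(k
  -- + 1) - n is twice h + 2t + 2.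
  gap₂-bound : ∀ {A B C x y z} → x + y + z ≤ 4 * h + 2 * t + 2 →
    2 * h + 2 * t + 2 + A ≤ B + x → 2 * h + 2 * t + 2 + B ≤ C + y →
    2 * h + 2 * t + 2 + A ≤ C + z → A + (h + 2 * t + 2) ≤ C
  gap₂-bound {A} {B} {C} {x} {y} {z} perimeter AB BC AC = *-cancelˡ-≤ 2
    (≤-by {2 * (A + (h + 2 * t + 2))} {2 * C} 0
      (+-mono-≤ perimeter (+-mono-≤ AB (+-mono-≤ BC AC)))
      (solve (h ∷ t ∷ A ∷ B ∷ C ∷ x ∷ y ∷ z ∷ [])))

  -- The inequalities `AB` and `BC` force x + y ≥ 3h + 2t + 2, hence z ≤ h by the perimeter bound;
  -- `AC` alone gives z ≥ h.
  gap₂-tight : ∀ {A B C x y z} → x + y + z ≤ 4 * h + 2 * t + 2 →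
    2 * h + 2 * t + 2 + A ≤ B + x → 2 * h + 2 * t + 2 + B ≤ C + y →
    2 * h + 2 * t + 2 + A ≤ C + z → A + (h + 2 * t + 2) ≡ C → z ≡ h
  gap₂-tight {A} {B} {C} {x} {y} {z} perimeter AB BC AC refl = ≤-antisym
    (≤-by {z} {h} 0 (+-mono-≤ perimeter (+-mono-≤ AB BC)) (solve (h ∷ t ∷ A ∷ B ∷ x ∷ y ∷ z ∷ [])))
    (≤-by {h} {z} 0 AC (solve (h ∷ t ∷ A ∷ z ∷ [])))

order-even : ∀ h t → 4 * h + 2 * t + 2 ≡ suc (suc ((2 * h + t) * 2))
order-even h t = solve (h ∷ t ∷ [])

-- Modulo m the multiplier is −x ≡ x m′; the summand y m keeps the coefficient of m on the right nonnegative.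
bezout-shift : ∀ {q h′ m′ x y} → q + x * suc h′ ≡ y * suc m′ →
  (x * m′ + y * suc m′) * suc h′ ≡ q + (x * suc h′ + y * h′) * suc m′
bezout-shift {q} {h′} {m′} {x} {y} eq = +-cancelʳ-≡ (x * suc h′) _ _ (begin
  (x * m′ + y * suc m′) * suc h′ + x * suc h′                   ≡⟨ expand ⟩
  x * suc h′ * suc m′ + y * h′ * suc m′ + y * suc m′            ≡⟨ cong (x * suc h′ * suc m′ + y * h′ * suc m′ +_) eq ⟨
  x * suc h′ * suc m′ + y * h′ * suc m′ + (q + x * suc h′)      ≡⟨ collect ⟩
  q + (x * suc h′ + y * h′) * suc m′ + x * suc h′               ∎)
  where
  open ≡-Reasoning
  expand : (x * m′ + y * suc m′) * suc h′ + x * suc h′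
         ≡ x * suc h′ * suc m′ + y * h′ * suc m′ + y * suc m′
  expand = solve (h′ ∷ m′ ∷ x ∷ y ∷ [])
  collect : x * suc h′ * suc m′ + y * h′ * suc m′ + (q + x * suc h′)
          ≡ q + (x * suc h′ + y * h′) * suc m′ + x * suc h′
  collect = solve (q ∷ h′ ∷ m′ ∷ x ∷ y ∷ [])

-- Read h = `η * q` and m = `M * q`. As M h = η m vanishes modulo m, only `l` matters in (l + r M)
-- h, and l h ≡ w s h ≡ w q.
slot-congruence : ∀ {q M η l r w s z c} → w * s ≡ l + z * M →
  s * (η * q) ≡ q + c * (M * q) →
  (l + r * M) * (η * q) + r + z * η * (M * q) ≡ r + w * q + (w * c + r * η) * (M * q)
slot-congruence {q} {M} {η} {l} {r} {w} {s} {z} {c} ws sh = begin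
  (l + r * M) * (η * q) + r + z * η * (M * q)      ≡⟨ regroup ⟩
  (l + z * M) * (η * q) + (r * η * (M * q) + r)    ≡⟨ cong (λ y → y * (η * q) + rest) ws ⟨
  w * s * (η * q) + (r * η * (M * q) + r)          ≡⟨ cong (_+ rest) (*-assoc w s (η * q)) ⟩
  w * (s * (η * q)) + (r * η * (M * q) + r)        ≡⟨ cong (λ y → w * y + rest) sh ⟩
  w * (q + c * (M * q)) + (r * η * (M * q) + r)    ≡⟨ collect ⟩
  r + w * q + (w * c + r * η) * (M * q)            ∎
  where
  open ≡-Reasoning
  rest : ℕ
  rest = r * η * (M * q) + r
  regroup : (l + r * M) * (η * q) + r + z * η * (M * q)
          ≡ (l + z * M) * (η * q) + (r * η * (M * q) + r)
  regroup = solve (q ∷ M ∷ η ∷ l ∷ r ∷ z ∷ [])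
  collect : w * (q + c * (M * q)) + (r * η * (M * q) + r)
          ≡ r + w * q + (w * c + r * η) * (M * q)
  collect = solve (q ∷ M ∷ η ∷ r ∷ w ∷ c ∷ [])

-- Here v - X = (a - b) m, and a - b has the parity of a + b; this parity decides between X and X +
-- m modulo 2m.
double-even : ∀ {X a v b m x} → X + a * m ≡ v + b * m → a + b ≡ x * 2 →
  v + x * (2 * m) ≡ X + 0 + a * (2 * m)
double-even {X} {a} {v} {b} {m} {x} eq a+b = begin
  v + x * (2 * m)          ≡⟨ cong (v +_) (*-assoc x 2 m) ⟨
  v + x * 2 * m            ≡⟨ cong (λ e → v + e * m) a+b ⟨
  v + (a + b) * m          ≡⟨ regroup ⟩
  v + b * m + a * m        ≡⟨ cong (_+ a * m) eq ⟨
  X + a * m + a * m        ≡⟨ collect ⟩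
  X + 0 + a * (2 * m)      ∎
  where
  open ≡-Reasoning
  regroup : v + (a + b) * m ≡ v + b * m + a * m
  regroup = solve (v ∷ a ∷ b ∷ m ∷ [])
  collect : X + a * m + a * m ≡ X + 0 + a * (2 * m)
  collect = solve (X ∷ a ∷ m ∷ [])

double-odd : ∀ {X a v b m x} → X + a * m ≡ v + b * m → a + b ≡ suc (x * 2) →
  v + suc x * (2 * m) ≡ X + m + a * (2 * m)
double-odd {X} {a} {v} {b} {m} {x} eq a+b = begin
  v + suc x * (2 * m)        ≡⟨ split ⟩
  v + suc (x * 2) * m + m    ≡⟨ cong (λ e → v + e * m + m) a+b ⟨
  v + (a + b) * m + m        ≡⟨ regroup ⟩
  v + b * m + a * m + m      ≡⟨ cong (λ e → e + a * m + m) eq ⟨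
  X + a * m + a * m + m      ≡⟨ collect ⟩
  X + m + a * (2 * m)        ∎
  where
  open ≡-Reasoning
  split : v + suc x * (2 * m) ≡ v + suc (x * 2) * m + m
  split = solve (v ∷ x ∷ m ∷ [])
  regroup : v + (a + b) * m + m ≡ v + b * m + a * m + m
  regroup = solve (v ∷ a ∷ b ∷ m ∷ [])
  collect : X + a * m + a * m + m ≡ X + m + a * (2 * m)
  collect = solve (X ∷ a ∷ m ∷ [])

offset-trans : ∀ {n u v U W a b a′ b′ s x y} → u + a * n ≡ U + b * n → v + a′ * n ≡ W + b′ * n →
  W + x * n ≡ U + s + y * n → v + (a′ + b + x) * n ≡ u + s + (a + b′ + y) * n
offset-trans {n} {u} {v} {U} {W} {a} {b} {a′} {b′} {s} {x} {y} eu ev es = begin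
  v + (a′ + b + x) * n                ≡⟨ expand ⟩
  v + a′ * n + (b * n + x * n)        ≡⟨ cong (_+ (b * n + x * n)) ev ⟩
  W + b′ * n + (b * n + x * n)        ≡⟨ swap₁ ⟩
  W + x * n + (b * n + b′ * n)        ≡⟨ cong (_+ (b * n + b′ * n)) es ⟩
  U + s + y * n + (b * n + b′ * n)    ≡⟨ swap₂ ⟩
  U + b * n + (s + y * n + b′ * n)    ≡⟨ cong (_+ (s + y * n + b′ * n)) eu ⟨
  u + a * n + (s + y * n + b′ * n)    ≡⟨ collect ⟩
  u + s + (a + b′ + y) * n            ∎
  where
  open ≡-Reasoning
  expand : v + (a′ + b + x) * n ≡ v + a′ * n + (b * n + x * n)
  expand = solve (v ∷ a′ ∷ b ∷ x ∷ n ∷ [])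
  swap₁ : W + b′ * n + (b * n + x * n) ≡ W + x * n + (b * n + b′ * n)
  swap₁ = solve (W ∷ b′ ∷ b ∷ x ∷ n ∷ [])
  swap₂ : U + s + y * n + (b * n + b′ * n) ≡ U + b * n + (s + y * n + b′ * n)
  swap₂ = solve (U ∷ s ∷ y ∷ b ∷ b′ ∷ n ∷ [])
  collect : u + a * n + (s + y * n + b′ * n) ≡ u + s + (a + b′ + y) * n
  collect = solve (u ∷ a ∷ s ∷ y ∷ b′ ∷ n ∷ [])

∣m-n∣+d-bound : ∀ {F F′ K d} → K + F ≤ F′ + d → K ≤ ∣ F - F′ ∣ + d
∣m-n∣+d-bound {F} {F′} {K} {d} le = ≤-by {K} {∣ F - F′ ∣ + d} 0
  (+-mono-≤ le (m≤n+∣n-m∣ F′ F)) (certificate ∣ F - F′ ∣)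
  where
  certificate : ∀ D → K + (F′ + d + (F + D)) + 0 ≡ D + d + (K + F + F′)
  certificate D = solve (K ∷ F ∷ F′ ∷ d ∷ D ∷ [])

module _ (h t : ℕ) where
  -- Verifications for the labeling of the upper bound. The `near` inequalities test the label gap
  -- against the offset s between two positions, the `far` ones against n - s. `P`, `Q` and `C`
  -- stand for i h, i φ and ⌊i/M⌋; `δ` is the growth of ⌊i/M⌋ from i to i + 1.
  antipodal-near : ∀ Q → 2 * h + 2 * t + 2 + (Q + 0) ≤ Q + (t + 1) + (2 * h + t + 1)
  antipodal-near Q = ≤-reflexive (solve (h ∷ t ∷ Q ∷ []))

  antipodal-far : ∀ Q →
    2 * h + 2 * t + 2 + (Q + 0) + (2 * h + t + 1) ≤ Q + (t + 1) + (4 * h + 2 * t + 2)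
  antipodal-far Q = ≤-reflexive (solve (h ∷ t ∷ Q ∷ []))

  antipodal-offset : ∀ X → X + (2 * h + t + 1) + 0 * (4 * h + 2 * t + 2)
    ≡ X + 0 + (2 * h + t + 1) + 0 * (4 * h + 2 * t + 2)
  antipodal-offset X = solve (h ∷ t ∷ X ∷ [])

  double-half : 2 * (2 * h + t + 1) ≡ 4 * h + 2 * t + 2
  double-half = solve (h ∷ t ∷ [])

  next-offset : ∀ P C δ e → h + P + (δ + C) + e + 0 * (4 * h + 2 * t + 2)
    ≡ P + C + e + (h + δ) + 0 * (4 * h + 2 * t + 2)
  next-offset P C δ e = solve (h ∷ t ∷ P ∷ C ∷ δ ∷ e ∷ [])

  next-offset-up : ∀ P C δ → h + P + (δ + C) + (2 * h + t + 1) + 0 * (4 * h + 2 * t + 2)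
    ≡ P + C + 0 + (h + δ + (2 * h + t + 1)) + 0 * (4 * h + 2 * t + 2)
  next-offset-up P C δ = solve (h ∷ t ∷ P ∷ C ∷ δ ∷ [])

  next-offset-down : ∀ P C δ → h + P + (δ + C) + 0 + 1 * (4 * h + 2 * t + 2)
    ≡ P + C + (2 * h + t + 1) + (h + δ + (2 * h + t + 1)) + 0 * (4 * h + 2 * t + 2)
  next-offset-down P C δ = solve (h ∷ t ∷ P ∷ C ∷ δ ∷ [])

  next-near : ∀ Q C δ e → 2 * h + 2 * t + 2 + (Q + C + e)
    ≤ h + 2 * t + 2 + Q + (δ + C) + e + (h + δ)
  next-near Q C δ e = ≤-by {l = 0} {0} (δ + δ) z≤n (solve (h ∷ t ∷ Q ∷ C ∷ δ ∷ e ∷ []))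

  next-far : ∀ Q C δ e → 2 * h + 2 * t + 2 + (Q + C + e) + (h + δ)
    ≤ h + 2 * t + 2 + Q + (δ + C) + e + (4 * h + 2 * t + 2)
  next-far Q C δ e = ≤-by {l = 0} {0} (2 * h + 2 * t + 2) z≤n (solve (h ∷ t ∷ Q ∷ C ∷ δ ∷ e ∷ []))

  next-near-up : ∀ Q C δ → 2 * h + 2 * t + 2 + (Q + C + 0)
    ≤ h + 2 * t + 2 + Q + (δ + C) + (t + 1) + (h + δ + (2 * h + t + 1))
  next-near-up Q C δ =
    ≤-by {l = 0} {0} (δ + δ + (2 * h + 2 * t + 2)) z≤n (solve (h ∷ t ∷ Q ∷ C ∷ δ ∷ []))

  next-far-up : ∀ Q C δ → 2 * h + 2 * t + 2 + (Q + C + 0) + (h + δ + (2 * h + t + 1))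
    ≤ h + 2 * t + 2 + Q + (δ + C) + (t + 1) + (4 * h + 2 * t + 2)
  next-far-up Q C δ = ≤-by {l = 0} {0} (2 * t + 2) z≤n (solve (h ∷ t ∷ Q ∷ C ∷ δ ∷ []))

  next-near-down : ∀ Q C δ → 2 * h + 2 * t + 2 + (Q + C + (t + 1))
    ≤ h + 2 * t + 2 + Q + (δ + C) + 0 + (h + δ + (2 * h + t + 1))
  next-near-down Q C δ = ≤-by {l = 0} {0} (2 * h + δ + δ) z≤n (solve (h ∷ t ∷ Q ∷ C ∷ δ ∷ []))

  -- The critical case, met with equality: n - s is h + t + 1 - δ and the labels differ by h + t + 1
  -- + δ. This is why labels as well as positions carry ⌊i/M⌋.
  next-far-down : ∀ Q C δ → 2 * h + 2 * t + 2 + (Q + C + (t + 1)) + (h + δ + (2 * h + t + 1))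
    ≤ h + 2 * t + 2 + Q + (δ + C) + 0 + (4 * h + 2 * t + 2)
  next-far-down Q C δ = ≤-reflexive (solve (h ∷ t ∷ Q ∷ C ∷ δ ∷ []))

  -- Two steps of φ exceed k + 1 by 2t + 2, which covers the possible loss of t + 1 from `e`.
  distant : ∀ {Q Q′ C C′ e e′} → 2 * (h + 2 * t + 2) + Q ≤ Q′ → C ≤ C′ → e ≤ t + 1 →
    2 * h + 2 * t + 2 + (Q + C + e) ≤ Q′ + C′ + e′
  distant {Q} {Q′} {C} {C′} {e} {e′} Q≤ C≤ e≤ =
    ≤-by {2 * h + 2 * t + 2 + (Q + C + e)} {Q′ + C′ + e′} (t + 1 + e′)
      (+-mono-≤ Q≤ (+-mono-≤ C≤ e≤)) (solve (h ∷ t ∷ Q ∷ Q′ ∷ C ∷ C′ ∷ e ∷ e′ ∷ []))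

  next-step≤n : ∀ {δ} → δ ≤ 1 → h + δ + (2 * h + t + 1) ≤ 4 * h + 2 * t + 2
  next-step≤n {δ} δ≤1 = ≤-by {h + δ + (2 * h + t + 1)} {4 * h + 2 * t + 2} (h + t) δ≤1
    (solve (h ∷ t ∷ δ ∷ []))

-- The second equation says -e ≡ s modulo n; passing from -e to `e′` = n - e adds one n, whence
-- `suc b`.
complement-offset : ∀ {n e e′ y s a b} → e′ + e ≡ n → y + a * n ≡ e + y + s + b * n →
  e′ + a * n + (e + y) ≡ s + suc b * n + (e + y)
complement-offset {n} {e} {e′} {y} {s} {a} {b} e′+e eq = begin
  e′ + a * n + (e + y)         ≡⟨ regroup ⟩
  e′ + e + (y + a * n)         ≡⟨ cong₂ _+_ e′+e eq ⟩
  n + (e + y + s + b * n)      ≡⟨ collect ⟩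
  s + suc b * n + (e + y)      ∎
  where
  open ≡-Reasoning
  regroup : e′ + a * n + (e + y) ≡ e′ + e + (y + a * n)
  regroup = solve (e′ ∷ a ∷ n ∷ e ∷ y ∷ [])
  collect : n + (e + y + s + b * n) ≡ s + suc b * n + (e + y)
  collect = solve (n ∷ e ∷ y ∷ s ∷ b ∷ [])

module _ (h t : ℕ) where
  n-as-half : 4 * h + 2 * t + 2 ≡ (2 * h + t + 1) * 2
  n-as-half = solve (h ∷ t ∷ [])

  n-as-order : 4 * h + 2 * t + 2 ≡ (2 * h + t) * 2 + 2
  n-as-order = solve (h ∷ t ∷ [])

  n-over-k : 4 * h + 2 * t + 2 ≡ h * 2 + 1 + (2 * h + 2 * t + 1)
  n-over-k = solve (h ∷ t ∷ [])

  k-over-half : 2 * h + 2 * t + 1 ≡ t + (2 * h + t + 1)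
  k-over-half = solve (h ∷ t ∷ [])

  triple-k : 3 * (2 * h + 2 * t + 1) + 3
    ≡ h + 2 * t + 2 + (h + 2 * t + 2) + (4 * h + 2 * t + 2)
  triple-k = solve (h ∷ t ∷ [])

  -- In this and the next lemmas `j` stands for (k - 1)/2 and `m` for n/2.
  n-from-h-t : ∀ {j m} → m ≡ j + 1 + h → j ≡ h + t → m * 2 ≡ 4 * h + 2 * t + 2
  n-from-h-t refl refl = solve (h ∷ t ∷ [])

  k-from-h-t : ∀ {j} → j ≡ h + t → 1 + j * 2 ≡ 2 * h + 2 * t + 1
  k-from-h-t refl = solve (h ∷ t ∷ [])

k<n-3⇒j+2<m : ∀ {j m} → 1 + j * 2 + 3 < m * 2 → (j + 2) * 2 < m * 2
k<n-3⇒j+2<m {j} {m} = subst (_< m * 2) certificate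
  where
  certificate : 1 + j * 2 + 3 ≡ (j + 2) * 2
  certificate = solve (j ∷ [])

m≤k⇒h≤j : ∀ {j h} → j + 1 + h ≤ 1 + j * 2 → h ≤ j
m≤k⇒h≤j {j} {h} le = ≤-by {h} {j} 0 le (solve (j ∷ h ∷ []))

subgroup-multiple : ∀ {e s h p c n} → s * h ≡ p + c * n → e * s * h ≡ e * p + e * c * n
subgroup-multiple {e} {s} {h} {p} {c} {n} eq = begin
  e * s * h            ≡⟨ *-assoc e s h ⟩
  e * (s * h)          ≡⟨ cong (e *_) eq ⟩
  e * (p + c * n)      ≡⟨ solve (e ∷ p ∷ c ∷ n ∷ []) ⟩
  e * p + e * c * n    ∎
  where open ≡-Reasoning

excess-shift : ∀ j o → suc (j + 2) + o ≡ j + 1 + suc (suc o)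
excess-shift j o = solve (j ∷ o ∷ [])

open import Defs
open import Data.Bool.Base using (Bool; true; false)
open import Data.Fin as Fin using (Fin; toℕ; fromℕ<)
open import Data.Fin.Properties using (toℕ-injective; toℕ<n; toℕ-fromℕ<; injective⇒≤)
open import Data.List.Base as List using (List; length; _++_; allFin)
open import Data.List.Membership.Propositional using (_∈_)
open import Data.List.Membership.Propositional.Properties using (∈-allFin; ∈-++⁺ˡ; ∈-++⁺ʳ)
open import Data.List.Properties using (length-++; length-tabulate)
open import Data.List.Relation.Binary.Permutation.Propositional using (↭-sym; ↭⇒↭ₛ)
open import Data.List.Relation.Binary.Permutation.Propositional.Properties using (↭-length; ∈-resp-↭)
open import Data.List.Relation.Binary.Permutation.Setoid.Properties using (Unique-resp-↭)
open import Data.List.Relation.Unary.All as All using (All; []; _∷_)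
open import Data.List.Relation.Unary.AllPairs using (_∷_)
open import Data.List.Relation.Unary.Any as Any using (here; there)
open import Data.List.Relation.Unary.Any.Properties using (lookup-index)
open import Data.List.Relation.Unary.Linked using (Linked; _∷_)
open import Data.List.Relation.Unary.Unique.Propositional using (Unique)
open import Data.List.Relation.Unary.Unique.Propositional.Properties using (allFin⁺)
import Data.List.Sort as Sort
open import Data.Nat.Divisibility
open import Data.Nat.DivMod
open import Data.Nat.GCD using (gcd; gcd-GCD; gcd-comm; gcd-greatest; gcd[m,n]∣m; gcd[m,n]∣n; gcd[m,n]≢0; module Bézout)
open import Data.Product using (Σ-syntax; _×_; _,_; proj₁; proj₂; ∃-syntax)
open import Data.Sum as Sum using (_⊎_; inj₁; inj₂)
open import Function using (_on_)
open import Relation.Binary.Definitions using (tri<; tri≈; tri>)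
import Relation.Binary.Construct.On as On
open import Relation.Nullary using (¬_; contradiction; yes; no)

-- The metric of the cycle

m≤n⇒∣m-n∣+m≡n : ∀ {m n} → m ≤ n → ∣ m - n ∣ + m ≡ n
m≤n⇒∣m-n∣+m≡n {m} m≤n = trans (cong (_+ m) (m≤n⇒∣m-n∣≡n∸m m≤n)) (m∸n+n≡m m≤n)

cyc : ℕ → ℕ → ℕ → ℕ
cyc n x y = ∣ x - y ∣ ⊓ (n ∸ ∣ x - y ∣)

cyc-sym : ∀ n x y → cyc n x y ≡ cyc n y x
cyc-sym n x y = cong (λ d → d ⊓ (n ∸ d)) (∣-∣-comm x y)

cyc≤∣-∣ : ∀ n x y → cyc n x y ≤ ∣ x - y ∣
cyc≤∣-∣ n x y = m⊓n≤m _ _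

cyc+∣-∣≤ : ∀ {n} x y → x < n → y < n → cyc n x y + ∣ x - y ∣ ≤ n
cyc+∣-∣≤ {n} x y x<n y<n = begin
  cyc n x y + ∣ x - y ∣         ≤⟨ +-monoˡ-≤ _ (m⊓n≤n ∣ x - y ∣ _) ⟩
  n ∸ ∣ x - y ∣ + ∣ x - y ∣     ≡⟨ m∸n+n≡m (≤-trans (∣m-n∣≤m⊔n x y) (⊔-lub (<⇒≤ x<n) (<⇒≤ y<n))) ⟩
  n                             ∎
  where open ≤-Reasoning

-- The direct arcs from a to b and from b to c, and the arc from c to a through 0, together go once
-- around the cycle.
cyc-perimeter-sorted : ∀ {n a b c} → a ≤ b → b ≤ c → c < n →
  cyc n a b + cyc n b c + cyc n a c ≤ n
cyc-perimeter-sorted {n} {a} {b} {c} a≤b b≤c c<n = +-cancelʳ-≤ ∣ a - c ∣ _ n (begin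
  cyc n a b + cyc n b c + cyc n a c + ∣ a - c ∣
    ≡⟨ +-assoc (cyc n a b + cyc n b c) _ _ ⟩
  cyc n a b + cyc n b c + (cyc n a c + ∣ a - c ∣)
    ≤⟨ +-mono-≤ (+-mono-≤ (cyc≤∣-∣ n a b) (cyc≤∣-∣ n b c))
                (cyc+∣-∣≤ a c (≤-<-trans (≤-trans a≤b b≤c) c<n) c<n) ⟩
  ∣ a - b ∣ + ∣ b - c ∣ + n
    ≡⟨ cong (_+ n) (+-cancelʳ-≡ a _ _ legs) ⟩
  ∣ a - c ∣ + n
    ≡⟨ +-comm _ n ⟩
  n + ∣ a - c ∣ ∎)
  where
  open ≤-Reasoning
  legs : ∣ a - b ∣ + ∣ b - c ∣ + a ≡ ∣ a - c ∣ + a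
  legs = begin-equality
    ∣ a - b ∣ + ∣ b - c ∣ + a     ≡⟨ cong (_+ a) (+-comm ∣ a - b ∣ _) ⟩
    ∣ b - c ∣ + ∣ a - b ∣ + a     ≡⟨ +-assoc ∣ b - c ∣ _ a ⟩
    ∣ b - c ∣ + (∣ a - b ∣ + a)   ≡⟨ cong (∣ b - c ∣ +_) (m≤n⇒∣m-n∣+m≡n a≤b) ⟩
    ∣ b - c ∣ + b                 ≡⟨ m≤n⇒∣m-n∣+m≡n b≤c ⟩
    c                             ≡⟨ m≤n⇒∣m-n∣+m≡n (≤-trans a≤b b≤c) ⟨
    ∣ a - c ∣ + a                 ∎

cyc-perimeter : ∀ {n} a b c → a < n → b < n → c < n →
  cyc n a b + cyc n b c + cyc n a c ≤ n
cyc-perimeter {n} a b c a<n b<n c<n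
  with ≤-total a b | ≤-total b c | ≤-total a c
... | inj₁ a≤b | inj₁ b≤c | _ = cyc-perimeter-sorted a≤b b≤c c<n
... | inj₂ b≤a | inj₂ c≤b | _ =
  subst (_≤ n)
    (trans (cong₂ _+_ (cong₂ _+_ (cyc-sym n c b) (cyc-sym n b a)) (cyc-sym n c a))
           (cong (_+ cyc n a c) (+-comm (cyc n b c) _)))
    (cyc-perimeter-sorted c≤b b≤a a<n)
... | inj₁ a≤b | inj₂ c≤b | inj₁ a≤c =
  subst (_≤ n)
    (trans (cong (λ z → cyc n a c + z + cyc n a b) (cyc-sym n c b))
           (+-reverse₃ (cyc n a c) (cyc n b c) (cyc n a b)))
    (cyc-perimeter-sorted a≤c c≤b b<n)
... | inj₁ a≤b | inj₂ c≤b | inj₂ c≤a =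
  subst (_≤ n)
    (trans (cong₂ (λ y z → y + cyc n a b + z) (cyc-sym n c a) (cyc-sym n c b))
           (+-rotateˡ₃ (cyc n a c) (cyc n a b) (cyc n b c)))
    (cyc-perimeter-sorted c≤a a≤b b<n)
... | inj₂ b≤a | inj₁ b≤c | inj₁ a≤c =
  subst (_≤ n)
    (trans (cong (λ z → z + cyc n a c + cyc n b c) (cyc-sym n b a))
           (+-swapʳ₃ (cyc n a b) (cyc n a c) (cyc n b c)))
    (cyc-perimeter-sorted b≤a a≤c c<n)
... | inj₂ b≤a | inj₁ b≤c | inj₂ c≤a =
  subst (_≤ n)
    (trans (cong₂ (λ y z → cyc n b c + y + z) (cyc-sym n c a) (cyc-sym n b a))
           (+-rotateʳ₃ (cyc n b c) (cyc n a c) (cyc n a b)))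
    (cyc-perimeter-sorted b≤c c≤a a<n)

-- A form of `cyc n x y ≤ ℓ` without minimum and subtraction, suited to induction along a walk: one
-- disjunct for each of the two arcs.
Near : ℕ → ℕ → ℕ → ℕ → Set
Near n x y ℓ = ∣ x - y ∣ ≤ ℓ ⊎ n ≤ ℓ + ∣ x - y ∣

Near-step : ∀ {n x w y ℓ} → ∣ x - w ∣ ≤ 1 → ∣ w - x ∣ ≤ 1 → Near n w y ℓ → Near n x y (suc ℓ)
Near-step {n} {x} {w} {y} xw _ (inj₁ near) =
  inj₁ (≤-trans (∣-∣-triangle x w y) (+-mono-≤ xw near))
Near-step {n} {x} {w} {y} {ℓ} _ wx (inj₂ far) = inj₂ (begin
  n                             ≤⟨ far ⟩
  ℓ + ∣ w - y ∣                 ≤⟨ +-monoʳ-≤ ℓ (∣-∣-triangle w x y) ⟩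
  ℓ + (∣ w - x ∣ + ∣ x - y ∣)   ≤⟨ +-monoʳ-≤ ℓ (+-monoˡ-≤ _ wx) ⟩
  ℓ + suc ∣ x - y ∣             ≡⟨ +-suc ℓ _ ⟩
  suc ℓ + ∣ x - y ∣             ∎)
  where open ≤-Reasoning

∣1+m-m∣≤1 : ∀ m → ∣ suc m - m ∣ ≤ 1
∣1+m-m∣≤1 zero = ≤-refl
∣1+m-m∣≤1 (suc m) = ∣1+m-m∣≤1 m

∣m-1+m∣≤1 : ∀ m → ∣ m - suc m ∣ ≤ 1
∣m-1+m∣≤1 m = subst (_≤ 1) (∣-∣-comm (suc m) m) (∣1+m-m∣≤1 m)

-- Crossing the edge between n - 1 and 0 exchanges the two arcs, so each disjunct turns into the
-- other.
Near-wrap-up : ∀ {n x y ℓ} → suc x ≡ n → y < n → Near n 0 y ℓ → Near n x y (suc ℓ)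
Near-wrap-up {_} {x} {y} refl _ (inj₁ y≤ℓ) =
  inj₂ (s≤s (≤-trans (m≤n+∣m-n∣ x y) (+-monoˡ-≤ _ y≤ℓ)))
Near-wrap-up {_} {x} {y} {ℓ} refl (s≤s y≤x) (inj₂ far) =
  inj₁ (m≤n⇒m≤1+n (subst (_≤ ℓ) (sym (m≤n⇒∣n-m∣≡n∸m y≤x))
    (m≤n+o⇒m∸n≤o x y (≤-trans (n≤1+n x) (subst (suc x ≤_) (+-comm ℓ y) far)))))

Near-wrap-down : ∀ {n w y ℓ} → suc w ≡ n → y < n → Near n w y ℓ → Near n 0 y (suc ℓ)
Near-wrap-down {_} {w} {y} refl _ (inj₁ near) =
  inj₂ (s≤s (≤-trans (m≤∣m-n∣+n w y) (+-monoˡ-≤ y near)))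
Near-wrap-down {_} {w} {y} {ℓ} refl (s≤s y≤w) (inj₂ far) =
  inj₁ (m≤n⇒m≤1+n (<⇒≤ (+-cancelʳ-≤ ∣ w - y ∣ (suc y) ℓ (begin
    suc y + ∣ w - y ∣  ≡⟨ cong suc (trans (+-comm y _)
                          (trans (cong (_+ y) (∣-∣-comm w y)) (m≤n⇒∣m-n∣+m≡n y≤w))) ⟩
    suc w              ≤⟨ far ⟩
    ℓ + ∣ w - y ∣      ∎))))
  where open ≤-Reasoning

walk⇒Near : ∀ {n u v ℓ} → Walk n u v ℓ → Near n (toℕ u) (toℕ v) ℓ
walk⇒Near {u = u} [] = inj₁ (≤-reflexive (∣n-n∣≡0 (toℕ u)))
walk⇒Near {u = u} (inj₁ w≡1+u ∷ walk) with walk⇒Near walk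
... | near rewrite w≡1+u =
  Near-step {x = toℕ u} {suc (toℕ u)} (∣m-1+m∣≤1 (toℕ u)) (∣1+m-m∣≤1 (toℕ u)) near
walk⇒Near (_∷_ {v = w} (inj₂ (inj₁ u≡1+w)) walk) rewrite u≡1+w =
  Near-step {x = suc (toℕ w)} {toℕ w} (∣1+m-m∣≤1 (toℕ w)) (∣m-1+m∣≤1 (toℕ w)) (walk⇒Near walk)
walk⇒Near {v = v} (inj₂ (inj₂ (inj₁ (1+u≡n , w≡0))) ∷ walk) with walk⇒Near walk
... | near rewrite w≡0 = Near-wrap-up 1+u≡n (toℕ<n v) near
walk⇒Near {v = v} (inj₂ (inj₂ (inj₂ (1+w≡n , u≡0))) ∷ walk) rewrite u≡0 =
  Near-wrap-down 1+w≡n (toℕ<n v) (walk⇒Near walk)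

Adj-sym : ∀ {n u v} → Adj n u v → Adj n v u
Adj-sym (inj₁ e) = inj₂ (inj₁ e)
Adj-sym (inj₂ (inj₁ e)) = inj₁ e
Adj-sym (inj₂ (inj₂ (inj₁ e))) = inj₂ (inj₂ (inj₂ e))
Adj-sym (inj₂ (inj₂ (inj₂ e))) = inj₂ (inj₂ (inj₁ e))

infixr 5 _++ʷ_
_++ʷ_ : ∀ {n u v w ℓ ℓ′} → Walk n u v ℓ → Walk n v w ℓ′ → Walk n u w (ℓ + ℓ′)
[] ++ʷ q = q
(e ∷ p) ++ʷ q = e ∷ (p ++ʷ q)

reverseʷ : ∀ {n u v ℓ} → Walk n u v ℓ → Walk n v u ℓ
reverseʷ [] = []
reverseʷ {n} {u} {v} {suc ℓ} (e ∷ p) =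
  subst (Walk n v u) (+-comm ℓ 1) (reverseʷ p ++ʷ (Adj-sym e ∷ []))

ascend : ∀ {n} d (u v : Fin n) → d + toℕ u ≡ toℕ v → Walk n u v d
ascend zero u v eq rewrite toℕ-injective eq = []
ascend {n} (suc d) u v eq = inj₁ (toℕ-fromℕ< 1+u<n) ∷ ascend d (fromℕ< 1+u<n) v
  (trans (cong (d +_) (toℕ-fromℕ< 1+u<n)) (trans (+-suc d (toℕ u)) eq))
  where
  1+u<n : suc (toℕ u) < n
  1+u<n = ≤-<-trans (subst (suc (toℕ u) ≤_) eq (s≤s (m≤n+m (toℕ u) d))) (toℕ<n v)

around : ∀ {n} (u v : Fin n) → toℕ u ≤ toℕ v → Walk n u v (n ∸ ∣ toℕ u - toℕ v ∣)
around {suc n} u v u≤v = subst (Walk (suc n) u v) length-eq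
  -- Down from `u` to 0, across the closing edge to the last vertex, and down to `v`.
  (reverseʷ (ascend (toℕ u) Fin.zero u (+-identityʳ _))
   ++ʷ inj₂ (inj₂ (inj₂ (cong suc (toℕ-fromℕ< ≤-refl) , refl)))
   ∷ reverseʷ (ascend (n ∸ toℕ v) v last (trans (m∸n+n≡m v≤n) (sym (toℕ-fromℕ< ≤-refl)))))
  where
  last : Fin (suc n)
  last = fromℕ< ≤-refl
  v≤n : toℕ v ≤ n
  v≤n = ≤-pred (toℕ<n v)
  open ≡-Reasoning
  length-eq : toℕ u + suc (n ∸ toℕ v) ≡ suc n ∸ ∣ toℕ u - toℕ v ∣
  length-eq = begin
    toℕ u + suc (n ∸ toℕ v)     ≡⟨ cong (toℕ u +_) (+-∸-assoc 1 v≤n) ⟨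
    toℕ u + (suc n ∸ toℕ v)     ≡⟨ +-∸-assoc (toℕ u) (<⇒≤ (toℕ<n v)) ⟨
    (toℕ u + suc n) ∸ toℕ v     ≡⟨ cong (toℕ u + suc n ∸_) (m+[n∸m]≡n u≤v) ⟨
    (toℕ u + suc n) ∸ (toℕ u + (toℕ v ∸ toℕ u)) ≡⟨ [m+n]∸[m+o]≡n∸o (toℕ u) (suc n) _ ⟩
    suc n ∸ (toℕ v ∸ toℕ u)     ≡⟨ cong (suc n ∸_) (m≤n⇒∣m-n∣≡n∸m u≤v) ⟨
    suc n ∸ ∣ toℕ u - toℕ v ∣   ∎

isDist-cyc : ∀ {n} (u v : Fin n) → IsDist n u v (cyc n (toℕ u) (toℕ v))
isDist-cyc {n} u v = walk , minimal
  where
  walk≤ : ∀ u v → toℕ u ≤ toℕ v → Walk n u v (cyc n (toℕ u) (toℕ v))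
  walk≤ u v u≤v with ⊓-sel ∣ toℕ u - toℕ v ∣ (n ∸ ∣ toℕ u - toℕ v ∣)
  ... | inj₁ eq rewrite eq = ascend _ u v (m≤n⇒∣m-n∣+m≡n u≤v)
  ... | inj₂ eq rewrite eq = around u v u≤v
  walk : Walk n u v (cyc n (toℕ u) (toℕ v))
  walk with ≤-total (toℕ u) (toℕ v)
  ... | inj₁ u≤v = walk≤ u v u≤v
  ... | inj₂ v≤u = subst (Walk n u v) (cyc-sym n (toℕ v) (toℕ u)) (reverseʷ (walk≤ v u v≤u))
  minimal : ∀ ℓ → Walk n u v ℓ → cyc n (toℕ u) (toℕ v) ≤ ℓ
  minimal ℓ p with walk⇒Near p
  ... | inj₁ near = ≤-trans (m⊓n≤m _ _) near
  ... | inj₂ far = ≤-trans (m⊓n≤n ∣ toℕ u - toℕ v ∣ _)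
    (m≤n+o⇒m∸n≤o n ∣ toℕ u - toℕ v ∣ (subst (n ≤_) (+-comm ℓ _) far))

-- Residues modulo a divisor of n

≤⇒≡% : ∀ {p x y} .{{_ : NonZero p}} → x ≤ y → p ∣ ∣ x - y ∣ → x % p ≡ y % p
≤⇒≡% {p} {x} {y} x≤y (divides c d≡cp) = begin
  x % p                  ≡⟨ [m+kn]%n≡m%n x c p ⟨
  (x + c * p) % p        ≡⟨ cong (λ z → (x + z) % p) d≡cp ⟨
  (x + ∣ x - y ∣) % p    ≡⟨ cong (_% p) (trans (+-comm x _) (m≤n⇒∣m-n∣+m≡n x≤y)) ⟩
  y % p                  ∎
  where open ≡-Reasoning

∣∣-∣⇒≡% : ∀ {p} x y .{{_ : NonZero p}} → p ∣ ∣ x - y ∣ → x % p ≡ y % p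
∣∣-∣⇒≡% {p} x y p∣d with ≤-total x y
... | inj₁ x≤y = ≤⇒≡% x≤y p∣d
... | inj₂ y≤x = sym (≤⇒≡% y≤x (subst (p ∣_) (∣-∣-comm x y) p∣d))

-- The two arcs add up to n, so p divides both as soon as it divides the shorter one.
∣cyc⇒≡% : ∀ {n p} .{{_ : NonZero p}} x y → x < n → y < n → p ∣ n →
  p ∣ cyc n x y → x % p ≡ y % p
∣cyc⇒≡% {n} {p} x y x<n y<n p∣n p∣cyc = ∣∣-∣⇒≡% x y p∣d
  where
  d : ℕ
  d = ∣ x - y ∣
  d≤n : d ≤ n
  d≤n = ≤-trans (∣m-n∣≤m⊔n x y) (⊔-lub (<⇒≤ x<n) (<⇒≤ y<n))
  p∣d : p ∣ d
  p∣d with ⊓-sel d (n ∸ d)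
  ... | inj₁ eq = subst (p ∣_) eq p∣cyc
  ... | inj₂ eq = ∣m+n∣m⇒∣n (subst (p ∣_) (sym (m∸n+n≡m d≤n)) p∣n) (subst (p ∣_) eq p∣cyc)

-- Lower bound

-- Sending each j to a position where it occurs is injective, since looking that position up
-- recovers j.
covering⇒≤length : ∀ p (xs : List ℕ) → (∀ j → j < p → j ∈ xs) → p ≤ length xs
covering⇒≤length p xs covers = injective⇒≤ {f = position} position-injective
  where
  position : Fin p → Fin (length xs)
  position j = Any.index (covers (toℕ j) (toℕ<n j))
  position-injective : ∀ {i j} → position i ≡ position j → i ≡ j
  position-injective {i} {j} eq = toℕ-injective (begin
    toℕ i                            ≡⟨ lookup-index (covers (toℕ i) (toℕ<n i)) ⟩
    List.lookup xs (position i)   ≡⟨ cong (List.lookup xs) eq ⟩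
    List.lookup xs (position j)   ≡⟨ lookup-index (covers (toℕ j) (toℕ<n j)) ⟨
    toℕ j                            ∎)
    where open ≡-Reasoning

-- Colours along every second vertex

module AlternatingChains
  {V : Set} (f colour : V → ℕ) (g φ top : ℕ)
  (f≤top : ∀ v → f v ≤ top)
  (gap₁ : ∀ {a b} → a ≢ b → f a ≤ f b → f a + g ≤ f b)
  (gap₂ : ∀ {a b c} → a ≢ b → b ≢ c → a ≢ c → f a ≤ f b → f b ≤ f c →
          (colour a ≡ colour c × f a + φ ≤ f c) ⊎ f a + φ < f c)
  where

  -- `C` lists the colours met on a chain that starts at `v` and takes every second vertex. Each
  -- entry beyond the first is paid for by one unit of label above `gaps`; the free first entry
  -- accounts for `suc top`.
  Palette : V → ℕ → List ℕ → Set
  Palette v gaps C = colour v ∈ C × f v + gaps + length C ≤ suc top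

  -- A step that may be tight keeps the colour, so the list stays. A slack step has a unit to spare,
  -- which pays for a new entry.
  extend : ∀ {a c gaps C} →
    (colour a ≡ colour c × f a + φ ≤ f c) ⊎ f a + φ < f c →
    Palette c gaps C → ∃[ C′ ] Palette a (φ + gaps) C′ × (∀ {x} → x ∈ C → x ∈ C′)
  extend {a} {c} {gaps} {C} (inj₁ (same , step)) (c∈C , bound) =
    C , (subst (_∈ C) (sym same) c∈C , (begin
      f a + (φ + gaps) + length C  ≡⟨ cong (_+ length C) (+-assoc (f a) φ gaps) ⟨
      f a + φ + gaps + length C    ≤⟨ +-monoˡ-≤ _ (+-monoˡ-≤ gaps step) ⟩
      f c + gaps + length C        ≤⟨ bound ⟩
      suc top                      ∎)) , λ x∈C → x∈C
    where open ≤-Reasoning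
  extend {a} {c} {gaps} {C} (inj₂ step) (c∈C , bound) =
    colour a ∷ C , (here refl , (begin
      f a + (φ + gaps) + suc (length C)   ≡⟨ +-suc _ _ ⟩
      suc (f a + (φ + gaps)) + length C   ≡⟨ cong (λ z → suc z + length C) (+-assoc (f a) φ gaps) ⟨
      suc (f a + φ) + gaps + length C     ≤⟨ +-monoˡ-≤ _ (+-monoˡ-≤ gaps step) ⟩
      f c + gaps + length C               ≤⟨ bound ⟩
      suc top                             ∎)) , there
    where open ≤-Reasoning

  -- Two interleaved chains, built from the end two vertices at a time. The first stops one vertex
  -- before the end, and the last gap supplies its `g`; the second reaches the final vertex.
  chains : ∀ j a b xs → length xs ≡ j * 2 → Unique (a ∷ b ∷ xs) →
    Linked (_≤_ on f) (a ∷ b ∷ xs) →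
    ∃[ C ] ∃[ D ] Palette a (j * φ + g) C × Palette b (j * φ) D
      × All (λ v → colour v ∈ C ⊎ colour v ∈ D) (a ∷ b ∷ xs)
  chains zero a b [] _ ((a≢b ∷ _) ∷ _) (a≤b ∷ _) =
    colour a ∷ [] , colour b ∷ [] ,
    (here refl , one (≤-trans (gap₁ a≢b a≤b) (f≤top b))) ,
    (here refl , one (≤-trans (≤-reflexive (+-identityʳ _)) (f≤top b))) ,
    inj₁ (here refl) ∷ inj₂ (here refl) ∷ []
    where
    one : ∀ {x} → x ≤ top → x + 1 ≤ suc top
    one {x} x≤top = subst (_≤ suc top) (+-comm 1 x) (s≤s x≤top)
  chains (suc j) a b (c ∷ d ∷ xs) len
    ((a≢b ∷ a≢c ∷ _) ∷ (b≢c ∷ b≢d ∷ _) ∷ unique@((c≢d ∷ _) ∷ _))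
    (a≤b ∷ b≤c ∷ linked@(c≤d ∷ _))
    with chains j c d xs (suc-injective (suc-injective len)) unique linked
  ... | C , D , palC , palD , cover
    with extend (gap₂ a≢b b≢c a≢c a≤b b≤c) palC | extend (gap₂ b≢c c≢d b≢d b≤c c≤d) palD
  ... | C′ , (a∈C′ , boundC) , C⊆C′ | D′ , palD′@(b∈D′ , _) , D⊆D′ =
    C′ , D′ ,
    (a∈C′ , subst (λ z → f a + z + length C′ ≤ suc top) (sym (+-assoc φ (j * φ) g)) boundC) ,
    palD′ ,
    inj₁ a∈C′ ∷ inj₂ b∈D′ ∷ All.map (Sum.map C⊆C′ D⊆D′) cover

  -- The second chain also gains `g`, at its start, from the gap between `a` and `b`. Both chains
  -- then give the same bound in terms of their numbers of entries, and the longer list has at least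
  -- ⌈p/2⌉ of them.
  chains-bound : ∀ j p a b xs → length xs ≡ j * 2 → Unique (a ∷ b ∷ xs) →
    Linked (_≤_ on f) (a ∷ b ∷ xs) →
    (∀ i → i < p → ∃[ v ] v ∈ (a ∷ b ∷ xs) × colour v ≡ i) →
    f a + (j * φ + g) + ⌈ p /2⌉ ≤ suc top
  chains-bound j p a b xs len unique@((a≢b ∷ _) ∷ _) linked@(a≤b ∷ _) colours
    with chains j a b xs len unique linked
  ... | C , D , (_ , boundC) , (_ , boundD) , cover = begin
    lb + ⌈ p /2⌉                    ≤⟨ +-monoʳ-≤ lb (⌈n/2⌉-mono p≤2w) ⟩
    lb + ⌈ w + w /2⌉                ≡⟨ cong (lb +_) (n≡⌈n+n/2⌉ w) ⟨
    lb + w                          ≡⟨ +-distribˡ-⊔ lb (length C) (length D) ⟩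
    (lb + length C) ⊔ (lb + length D)   ≤⟨ ⊔-lub boundC boundD′ ⟩
    suc top                         ∎
    where
    open ≤-Reasoning
    lb w : ℕ
    lb = f a + (j * φ + g)
    w = length C ⊔ length D
    boundD′ : lb + length D ≤ suc top
    boundD′ = begin
      f a + (j * φ + g) + length D   ≡⟨ cong (λ z → f a + z + length D) (+-comm (j * φ) g) ⟩
      f a + (g + j * φ) + length D   ≡⟨ cong (_+ length D) (+-assoc (f a) g _) ⟨
      f a + g + j * φ + length D     ≤⟨ +-monoˡ-≤ (length D) (+-monoˡ-≤ (j * φ) (gap₁ a≢b a≤b)) ⟩
      f b + j * φ + length D         ≤⟨ boundD ⟩
      suc top                        ∎
    covers : ∀ i → i < p → i ∈ C ++ D
    covers i i<p with colours i i<p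
    ... | v , v∈xs , refl with All.lookup cover v∈xs
    ... | inj₁ v∈C = ∈-++⁺ˡ v∈C
    ... | inj₂ v∈D = ∈-++⁺ʳ C v∈D
    p≤2w : p ≤ w + w
    p≤2w = begin
      p                      ≤⟨ covering⇒≤length p (C ++ D) covers ⟩
      length (C ++ D)        ≡⟨ length-++ C ⟩
      length C + length D    ≤⟨ +-mono-≤ (m≤m⊔n (length C) (length D)) (m≤n⊔m (length C) (length D)) ⟩
      w + w                  ∎

module LowerBound (h t p : ℕ) .{{_ : NonZero p}} (p∣n : p ∣ 4 * h + 2 * t + 2) (p∣h : p ∣ h)
  (f : Fin (4 * h + 2 * t + 2) → ℕ)
  (radio : IsRadioLabeling (4 * h + 2 * t + 2) (2 * h + 2 * t + 1) f) where

  private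
    n φ : ℕ
    n = 4 * h + 2 * t + 2
    φ = h + 2 * t + 2
    V : Set
    V = Fin n

  gap : ∀ {a b} → a ≢ b → f a ≤ f b →
    2 * h + 2 * t + 2 + f a ≤ f b + cyc n (toℕ a) (toℕ b)
  gap {a} {b} a≢b a≤b = begin
    2 * h + 2 * t + 2 + f a              ≡⟨ cong (_+ f a) (+-assoc (2 * h + 2 * t) 1 1) ⟨
    2 * h + 2 * t + 1 + 1 + f a          ≤⟨ +-monoˡ-≤ (f a) (radio a b a≢b _ (isDist-cyc a b)) ⟩
    ∣ f a - f b ∣ + d + f a              ≡⟨ +-assoc ∣ f a - f b ∣ d (f a) ⟩
    ∣ f a - f b ∣ + (d + f a)            ≡⟨ cong (∣ f a - f b ∣ +_) (+-comm d (f a)) ⟩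
    ∣ f a - f b ∣ + (f a + d)            ≡⟨ +-assoc ∣ f a - f b ∣ (f a) d ⟨
    ∣ f a - f b ∣ + f a + d              ≡⟨ cong (_+ d) (m≤n⇒∣m-n∣+m≡n a≤b) ⟩
    f b + d                              ∎
    where
    open ≤-Reasoning
    d : ℕ
    d = cyc n (toℕ a) (toℕ b)

  gap₁ : ∀ {a b} → a ≢ b → f a ≤ f b → f a + (t + 1) ≤ f b
  gap₁ {a} {b} a≢b a≤b = gap₁-bound h t (cyc≤∣-∣ n (toℕ a) (toℕ b))
    (cyc+∣-∣≤ (toℕ a) (toℕ b) (toℕ<n a) (toℕ<n b)) (gap a≢b a≤b)

  gap₂ : ∀ {a b c} → a ≢ b → b ≢ c → a ≢ c → f a ≤ f b → f b ≤ f c →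
    (toℕ a % p ≡ toℕ c % p × f a + φ ≤ f c) ⊎ f a + φ < f c
  gap₂ {a} {b} {c} a≢b b≢c a≢c a≤b b≤c with m≤n⇒m<n∨m≡n
      (gap₂-bound h t perimeter (gap a≢b a≤b) (gap b≢c b≤c) (gap a≢c (≤-trans a≤b b≤c)))
    where
    perimeter = cyc-perimeter (toℕ a) (toℕ b) (toℕ c) (toℕ<n a) (toℕ<n b) (toℕ<n c)
  ... | inj₁ slack = inj₂ slack
  ... | inj₂ tight = inj₁ (∣cyc⇒≡% (toℕ a) (toℕ c) (toℕ<n a) (toℕ<n c) p∣n
      (subst (p ∣_) (sym (gap₂-tight h t perimeter (gap a≢b a≤b) (gap b≢c b≤c)
                           (gap a≢c (≤-trans a≤b b≤c)) tight)) p∣h)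
    , ≤-reflexive tight)
    where
    perimeter = cyc-perimeter (toℕ a) (toℕ b) (toℕ c) (toℕ<n a) (toℕ<n b) (toℕ<n c)

  open Sort (On.decTotalOrder ≤-decTotalOrder f) using (sort; sort-↭; sort-↗)

  span-bound : ∀ s → (∀ u v → ∣ f u - f v ∣ ≤ s) →
    (2 * h + t) * φ + (t + 1) + ⌈ p /2⌉ ≤ suc s
  span-bound s spread = split (sort (allFin n)) sorted-length sorted-unique
    (sort-↗ (allFin n)) (λ v → ∈-resp-↭ (↭-sym (sort-↭ (allFin n))) (∈-allFin v))
    where
    sorted-length : length (sort (allFin n)) ≡ suc (suc ((2 * h + t) * 2))
    sorted-length = trans (↭-length (sort-↭ (allFin n)))
      (trans (length-tabulate (λ v → v)) (order-even h t))
    sorted-unique : Unique (sort (allFin n))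
    sorted-unique =
      Unique-resp-↭ (setoid V) (↭⇒↭ₛ (↭-sym (sort-↭ (allFin n)))) (allFin⁺ n)
    p≤n : p ≤ n
    p≤n = ∣⇒≤ {{>-nonZero (subst (0 <_) (sym (order-even h t)) z<s)}} p∣n
    split : ∀ xs → length xs ≡ suc (suc ((2 * h + t) * 2)) → Unique xs →
      Linked (_≤_ on f) xs → (∀ v → v ∈ xs) →
      (2 * h + t) * φ + (t + 1) + ⌈ p /2⌉ ≤ suc s
    split (a ∷ b ∷ xs) len unique linked everything =
      +-cancelˡ-≤ (f a) _ _ (begin
        f a + ((2 * h + t) * φ + (t + 1) + ⌈ p /2⌉)   ≡⟨ +-assoc (f a) _ ⌈ p /2⌉ ⟨
        f a + ((2 * h + t) * φ + (t + 1)) + ⌈ p /2⌉   ≤⟨ chains-bound (2 * h + t) p a b xs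
                                                           (suc-injective (suc-injective len))
                                                           unique linked residues ⟩
        suc (f a + s)                                 ≡⟨ +-suc (f a) s ⟨
        f a + suc s                                   ∎)
      where
      open ≤-Reasoning
      below : ∀ v → f v ≤ f a + s
      below v = ≤-trans (m≤n+∣n-m∣ (f v) (f a)) (+-monoʳ-≤ (f a) (spread a v))
      -- Colours are residues modulo p. The ceiling is measured from the label `f a` of the first
      -- vertex in sorted order, which cancels at the end.
      open AlternatingChains f (λ v → toℕ v % p) (t + 1) φ (f a + s) below gap₁ gap₂
      residues : ∀ i → i < p → ∃[ v ] v ∈ (a ∷ b ∷ xs) × toℕ v % p ≡ i
      residues i i<p = fromℕ< i<n , everything _ ,
        trans (cong (_% p) (toℕ-fromℕ< i<n)) (m<n⇒m%n≡m i<p)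
        where
        i<n : i < n
        i<n = ≤-trans i<p p≤n

-- Upper bound

bézout : ∀ h m .{{_ : NonZero h}} .{{_ : NonZero m}} →
  ∃[ s ] ∃[ c ] s * h ≡ gcd h m + c * m
bézout h@(suc h′) m@(suc m′) with Bézout.identity (gcd-GCD h m)
... | Bézout.+- x y eq = x , y , sym eq
... | Bézout.-+ x y eq = x * m′ + y * m , x * h + y * h′ , bezout-shift {x = x} {y} eq

-- Congruence modulo n, with multiples of n allowed on both sides to avoid subtraction.
Cong : ℕ → ℕ → ℕ → Set
Cong n x y = ∃[ a ] ∃[ b ] x + a * n ≡ y + b * n

Cong-residue : ∀ {n e s} .{{_ : NonZero n}} → e < n → s ≤ n → Cong n e s →
  e ≡ s ⊎ (e ≡ 0 × s ≡ n)
Cong-residue {n} {e} {s} e<n s≤n (a , b , eq) with m≤n⇒m<n∨m≡n s≤n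
... | inj₁ s<n = inj₁ (begin
  e                  ≡⟨ m<n⇒m%n≡m e<n ⟨
  e % n              ≡⟨ [m+kn]%n≡m%n e a n ⟨
  (e + a * n) % n    ≡⟨ cong (_% n) eq ⟩
  (s + b * n) % n    ≡⟨ [m+kn]%n≡m%n s b n ⟩
  s % n              ≡⟨ m<n⇒m%n≡m s<n ⟩
  s                  ∎)
  where open ≡-Reasoning
... | inj₂ refl = inj₂ ((begin
  e                    ≡⟨ m<n⇒m%n≡m e<n ⟨
  e % s                ≡⟨ [m+kn]%n≡m%n e a s ⟨
  (e + a * s) % s      ≡⟨ cong (_% s) eq ⟩
  (suc b * s) % s      ≡⟨ m*n%n≡0 (suc b) s ⟩
  0                    ∎) , refl)
  where open ≡-Reasoning

-- If x ≤ y, then |x - y| is congruent to s; otherwise n - |x - y| is, and it lies below n because x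
-- ≠ y.
offset⇒∣-∣ : ∀ {n x y s} → x < n → y < n → s ≤ n → Cong n y (x + s) →
  ∣ x - y ∣ ≡ s ⊎ ∣ x - y ∣ + s ≡ n
offset⇒∣-∣ {suc n-1} {x} {y} {s} x<n y<n s≤n (a , b , eq) with x ≤? y
... | yes x≤y = Sum.map₂ (λ (e≡0 , s≡n) → trans (cong (_+ s) e≡0) s≡n)
  (Cong-residue (≤-<-trans (subst (∣ x - y ∣ ≤_) (m≤n⇒∣m-n∣+m≡n x≤y) (m≤m+n _ x)) y<n) s≤n
    (a , b , +-cancelʳ-≡ x _ _ (begin
      e + a * n + x     ≡⟨ +-assoc e _ x ⟩
      e + (a * n + x)   ≡⟨ cong (e +_) (+-comm _ x) ⟩
      e + (x + a * n)   ≡⟨ +-assoc e x _ ⟨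
      e + x + a * n     ≡⟨ cong (_+ a * n) (m≤n⇒∣m-n∣+m≡n x≤y) ⟩
      y + a * n         ≡⟨ eq ⟩
      x + s + b * n     ≡⟨ +-assoc x s _ ⟩
      x + (s + b * n)   ≡⟨ +-comm x _ ⟩
      s + b * n + x     ∎)))
  where
  open ≡-Reasoning
  n e : ℕ
  n = suc n-1
  e = ∣ x - y ∣
... | no x≰y = inj₂ complement
  where
  open ≡-Reasoning
  n e e′ : ℕ
  n = suc n-1
  e = ∣ x - y ∣
  e′ = n ∸ e
  y≤x : y ≤ x
  y≤x = <⇒≤ (≰⇒> x≰y)
  e+y≡x : e + y ≡ x
  e+y≡x = trans (cong (_+ y) (∣-∣-comm x y)) (m≤n⇒∣m-n∣+m≡n y≤x)
  e<n : e < n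
  e<n = ≤-<-trans (subst (e ≤_) e+y≡x (m≤m+n e y)) x<n
  e′+e≡n : e′ + e ≡ n
  e′+e≡n = m∸n+n≡m (<⇒≤ e<n)
  0<e : 0 < e
  0<e = n≢0⇒n>0 λ e≡0 → x≰y (≤-reflexive (∣m-n∣≡0⇒m≡n e≡0))
  complement : e + s ≡ n
  complement with Cong-residue (∸-monoʳ-< 0<e (<⇒≤ e<n)) s≤n
    (a , suc b , +-cancelʳ-≡ (e + y) _ _ (complement-offset {n} {e} {e′} {y} {s} {a} {b} e′+e≡n
      (trans eq (cong (λ z → z + s + b * n) (sym e+y≡x)))))
  ... | inj₁ e′≡s = trans (+-comm e s) (trans (cong (_+ e) (sym e′≡s)) e′+e≡n)
  ... | inj₂ (e′≡0 , _) = contradiction (trans (cong (_+ e) (sym e′≡0)) e′+e≡n) (<⇒≢ e<n)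

-- The walk follows one of two arcs, and s measures one of the two: if they agree, s ≤ ℓ, otherwise
-- n - s ≤ ℓ. Distances in the labeling thus need only offsets modulo n.
walk-offset : ∀ {n s ℓ} {u v : Fin n} → s ≤ n → Cong n (toℕ v) (toℕ u + s) → Walk n u v ℓ →
  s ≤ ℓ ⊎ n ≤ ℓ + s
walk-offset {n} {s} {ℓ} {u} {v} s≤n congruent walk
  with walk⇒Near walk | offset⇒∣-∣ (toℕ<n u) (toℕ<n v) s≤n congruent
... | inj₁ near | inj₁ d≡s = inj₁ (subst (_≤ ℓ) d≡s near)
... | inj₁ near | inj₂ d+s≡n = inj₂ (subst (_≤ ℓ + s) d+s≡n (+-monoˡ-≤ s near))
... | inj₂ far | inj₁ d≡s = inj₂ (subst (λ z → n ≤ ℓ + z) d≡s far)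
... | inj₂ far | inj₂ d+s≡n = inj₁ (+-cancelʳ-≤ ∣ toℕ u - toℕ v ∣ s ℓ
  (subst (_≤ ℓ + ∣ toℕ u - toℕ v ∣) (trans (sym d+s≡n) (+-comm ∣ toℕ u - toℕ v ∣ s)) far))

-- The side within an antipodal pair: `true` adds m to a position and g to a label.
half : Bool → ℕ → ℕ
half false x = 0
half true x = x

half≤ : ∀ ε x → half ε x ≤ x
half≤ false x = z≤n
half≤ true x = ≤-refl

even⊎odd : ∀ n → ∃[ x ] (n ≡ x * 2 ⊎ n ≡ suc (x * 2))
even⊎odd zero = 0 , inj₁ refl
even⊎odd (suc n) with even⊎odd n
... | x , inj₁ eq = x , inj₂ (cong suc eq)
... | x , inj₂ eq = suc x , inj₁ (cong suc eq)

Cong-double : ∀ {m X v} → Cong m X v → ∃[ ε ] Cong (2 * m) v (X + half ε m)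
Cong-double {m} {X} {v} (a , b , eq) with even⊎odd (a + b)
... | x , inj₁ even = false , x , a , double-even {X} {a} {v} {b} {m} {x} eq even
... | x , inj₂ odd = true , suc x , a , double-odd {X} {a} {v} {b} {m} {x} eq odd

argmax : ∀ {n} (g : Fin (suc n) → ℕ) → ∃[ v ] (∀ u → g u ≤ g v)
argmax {zero} g = Fin.zero , λ { Fin.zero → ≤-refl }
argmax {suc n} g with argmax (λ u → g (Fin.suc u))
... | v , max with ≤-total (g Fin.zero) (g (Fin.suc v))
... | inj₁ le = Fin.suc v , λ { Fin.zero → le ; (Fin.suc u) → max u }
... | inj₂ ge = Fin.zero , λ { Fin.zero → ≤-refl ; (Fin.suc u) → ≤-trans (max u) ge }

bounded⇒span : ∀ {n B} .{{_ : NonZero n}} (f : Fin n → ℕ) → (∀ v → f v < B) →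
  ∃[ s ] IsSpan n f s × s < B
bounded⇒span {suc n} f f<B =
  ∣ f u₀ - f (farthest u₀) ∣ ,
  ((λ u v → ≤-trans (proj₂ (argmax (λ v → ∣ f u - f v ∣)) v) (proj₂ widest u)) ,
   u₀ , farthest u₀ , refl) ,
  ≤-<-trans (∣m-n∣≤m⊔n (f u₀) _) (⊔-pres-<m (f<B u₀) (f<B _))
  where
  farthest : Fin (suc n) → Fin (suc n)
  farthest u = proj₁ (argmax (λ v → ∣ f u - f v ∣))
  widest : ∃[ v ] (∀ u → ∣ f u - f (farthest u) ∣ ≤ ∣ f v - f (farthest v) ∣)
  widest = argmax (λ u → ∣ f u - f (farthest u) ∣)
  u₀ : Fin (suc n)
  u₀ = proj₁ widest

quotient-of-slot : ∀ {l M} r .{{_ : NonZero M}} → l < M → (l + r * M) / M ≡ r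
quotient-of-slot {l} {M} r l<M = begin
  (l + r * M) / M        ≡⟨ +-distrib-/-∣ʳ l (divides-refl r) ⟩
  l / M + r * M / M      ≡⟨ cong₂ _+_ (m<n⇒m/n≡0 l<M) (m*n/n≡m r M) ⟩
  r                      ∎
  where open ≡-Reasoning

-- Write v = r + w q with r < q. The block number ⌊i/M⌋ supplies r. Within the block w q must be a
-- multiple of h modulo m, and s h ≡ q gives the multiplier w s, reduced modulo `M`.
slot-exists : ∀ {q M η} .{{_ : NonZero q}} .{{_ : NonZero M}} s c →
  s * (η * q) ≡ q + c * (M * q) → ∀ v →
  ∃[ i ] i < M * q × Cong (M * q) (i * (η * q) + i / M) v
slot-exists {q} {M} {η} s c sh v = l + r * M , i<m , z * η , w * c + r * η , (begin
  (l + r * M) * (η * q) + (l + r * M) / M + z * η * (M * q)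
    ≡⟨ cong (λ y → (l + r * M) * (η * q) + y + z * η * (M * q)) (quotient-of-slot r l<M) ⟩
  (l + r * M) * (η * q) + r + z * η * (M * q)
    ≡⟨ slot-congruence {q} {M} {η} {l} {r} {w} {s} {z} {c} (m≡m%n+[m/n]*n (w * s) M) sh ⟩
  r + w * q + (w * c + r * η) * (M * q)
    ≡⟨ cong (_+ (w * c + r * η) * (M * q)) (m≡m%n+[m/n]*n v q) ⟨
  v + (w * c + r * η) * (M * q) ∎)
  where
  r w l z : ℕ
  r = v % q
  w = v / q
  l = w * s % M
  z = w * s / M
  l<M : l < M
  l<M = m%n<n (w * s) M
  i<m : l + r * M < M * q
  i<m = begin-strict
    l + r * M    <⟨ +-monoˡ-< (r * M) l<M ⟩
    suc r * M    ≤⟨ *-monoˡ-≤ M (m%n<n v q) ⟩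
    q * M        ≡⟨ *-comm q M ⟩
    M * q        ∎
    where open ≤-Reasoning
  open ≡-Reasoning

suc/≤ : ∀ i M .{{_ : NonZero M}} → suc i / M ≤ suc (i / M)
suc/≤ i M = begin
  suc i / M            ≤⟨ /-monoˡ-≤ M (+-monoˡ-≤ i (>-nonZero⁻¹ M)) ⟩
  (M + i) / M          ≡⟨ +-distrib-/-∣ˡ i ∣-refl ⟩
  M / M + i / M        ≡⟨ cong (_+ i / M) (n/n≡1 M) ⟩
  suc (i / M)          ∎
  where open ≤-Reasoning

-- X, X′ are positions modulo n and F, F′ labels.  An offset s between the positions
-- means a distance of s ⊓ (n ∸ s), hence the two inequalities.
Separated : (n K X F X′ F′ : ℕ) → Set
Separated n K X F X′ F′ =
  K + F ≤ F′
  ⊎ ∃[ s ] s ≤ n × Cong n X′ (X + s) × K + F ≤ F′ + s × K + F + s ≤ F′ + n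

Cong-offset : ∀ {n u v X X′ s} → Cong n u X → Cong n v X′ → Cong n X′ (X + s) → Cong n v (u + s)
Cong-offset {n} {u} {v} {X} {X′} {s} (a , b , eu) (a′ , b′ , ev) (x , y , es) =
  a′ + b + x , a + b′ + y , offset-trans {n} {u} {v} {X} {X′} {a} {b} {a′} {b′} {s} {x} {y} eu ev es

separated⇒radio : ∀ {n K X F X′ F′ d} {u v : Fin n} → Cong n (toℕ u) X → Cong n (toℕ v) X′ →
  Separated n K X F X′ F′ → Walk n u v d → K ≤ ∣ F - F′ ∣ + d
separated⇒radio {F = F} {F′ = F′} {d} _ _ (inj₁ le) _ =
  ∣m-n∣+d-bound {F} {F′} (≤-trans le (m≤m+n F′ d))
separated⇒radio {F = F} {F′ = F′} {d} cu cv (inj₂ (s , s≤n , congruent , near , far)) walk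
  with walk-offset s≤n (Cong-offset cu cv congruent) walk
... | inj₁ s≤d = ∣m-n∣+d-bound {F} {F′} (≤-trans near (+-monoʳ-≤ F′ s≤d))
... | inj₂ n≤d+s = ∣m-n∣+d-bound {F} {F′}
  (+-cancelʳ-≤ s _ _ (≤-trans far (≤-trans (+-monoʳ-≤ F′ n≤d+s)
    (≤-reflexive (sym (+-assoc F′ d s))))))

Cong-unique : ∀ {n X} {u v : Fin n} → Cong n (toℕ u) X → Cong n (toℕ v) X → u ≡ v
Cong-unique {n} {X} {u} {v} cu cv
  with offset⇒∣-∣ (toℕ<n u) (toℕ<n v) z≤n
         (Cong-offset cu cv (0 , 0 , cong (_+ 0) (sym (+-identityʳ X))))
... | inj₁ d≡0 = toℕ-injective (∣m-n∣≡0⇒m≡n d≡0)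
... | inj₂ d+0≡n = contradiction (trans (sym (+-identityʳ _)) d+0≡n)
  (<⇒≢ (≤-<-trans (∣m-n∣≤m⊔n (toℕ u) (toℕ v)) (⊔-pres-<m (toℕ<n u) (toℕ<n v))))

-- The labeling and its span

module UpperBound (h t q M : ℕ) .{{_ : NonZero M}}
  (m≡Mq : 2 * h + t + 1 ≡ M * q)
  (slot : ∀ v → ∃[ i ] i < 2 * h + t + 1 × Cong (2 * h + t + 1) (i * h + i / M) v)
  where

  private
    n m φ g K : ℕ
    n = 4 * h + 2 * t + 2
    m = 2 * h + t + 1
    φ = h + 2 * t + 2
    g = t + 1
    K = 2 * h + 2 * t + 2

    position label : ℕ → Bool → ℕ
    position i ε = i * h + i / M + half ε m
    label i ε = i * φ + i / M + half ε g

    m≤n : m ≤ n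
    m≤n = subst (m ≤_) (double-half h t) (m≤m+n m (m + 0))

    Apart : ℕ → Bool → ℕ → Bool → Set
    Apart i ε i′ ε′ = Separated n K (position i ε) (label i ε) (position i′ ε′) (label i′ ε′)

    separated-antipodal : ∀ i → Apart i false i true
    separated-antipodal i = inj₂ (m , m≤n , (0 , 0 , antipodal-offset h t (i * h + i / M)) ,
      antipodal-near h t (i * φ + i / M) , antipodal-far h t (i * φ + i / M))

    carry : ∀ i → ∃[ δ ] δ ≤ 1 × suc i / M ≡ δ + i / M
    carry i = suc i / M ∸ i / M , δ≤1 , sym (m∸n+n≡m (/-monoˡ-≤ M (n≤1+n i)))
      where
      δ≤1 : suc i / M ∸ i / M ≤ 1
      δ≤1 = m≤n+o⇒m∸n≤o (suc i / M) (i / M)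
        (subst (suc i / M ≤_) (+-comm 1 (i / M)) (suc/≤ i M))

    -- Equal sides have offset h + δ. From an antipode back to the other side the offset is h + δ -
    -- m, which is h + δ + m modulo n = 2m; hence the coefficient 1 in the last case.
    separated-next : ∀ i ε ε′ → Apart i ε (suc i) ε′
    separated-next i ε ε′ with carry i
    ... | δ , δ≤1 , eq rewrite eq = inj₂ (cases ε ε′)
      where
      P Q C : ℕ
      P = i * h
      Q = i * φ
      C = i / M
      s≤n : h + δ ≤ n
      s≤n = ≤-trans (m≤m+n (h + δ) m) (next-step≤n h t δ≤1)
      cases : ∀ ε ε′ → ∃[ s ] s ≤ n
        × Cong n (h + P + (δ + C) + half ε′ m) (P + C + half ε m + s)
        × K + (Q + C + half ε g) ≤ φ + Q + (δ + C) + half ε′ g + s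
        × K + (Q + C + half ε g) + s ≤ φ + Q + (δ + C) + half ε′ g + n
      cases false false = h + δ , s≤n , (0 , 0 , next-offset h t P C δ 0) ,
        next-near h t Q C δ 0 , next-far h t Q C δ 0
      cases true true = h + δ , s≤n , (0 , 0 , next-offset h t P C δ m) ,
        next-near h t Q C δ g , next-far h t Q C δ g
      cases false true = h + δ + m , next-step≤n h t δ≤1 , (0 , 0 , next-offset-up h t P C δ) ,
        next-near-up h t Q C δ , next-far-up h t Q C δ
      cases true false = h + δ + m , next-step≤n h t δ≤1 , (1 , 0 , next-offset-down h t P C δ) ,
        next-near-down h t Q C δ , next-far-down h t Q C δ

    -- For indices at least two apart the labels alone differ by k + 1; only consecutive indices
    -- involve positions.
    separated-< : ∀ {i i′} ε ε′ → i < i′ → Apart i ε i′ ε′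
    separated-< {i} {i′} ε ε′ i<i′ with m≤n⇒m<n∨m≡n i<i′
    ... | inj₂ refl = separated-next i ε ε′
    ... | inj₁ 1+i<i′ = inj₁ (distant h t {e′ = half ε′ g}
      (subst (_≤ i′ * φ) (*-distribʳ-+ φ 2 i) (*-monoˡ-≤ φ 1+i<i′))
      (/-monoˡ-≤ M (<⇒≤ i<i′)) (half≤ ε g))

    placement : ∀ (v : Fin n) → ∃[ i ] i < m × ∃[ ε ] Cong n (toℕ v) (position i ε)
    placement v with slot (toℕ v)
    ... | i , i<m , congruent =
      i , i<m , subst (λ z → ∃[ ε ] Cong z (toℕ v) (position i ε)) (double-half h t) (Cong-double congruent)

    index : Fin n → ℕ
    index v = proj₁ (placement v)
    side : Fin n → Bool
    side v = proj₁ (proj₂ (proj₂ (placement v)))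

  labeling : Fin n → ℕ
  labeling v = label (index v) (side v)

  private
    placed : ∀ v → Cong n (toℕ v) (position (index v) (side v))
    placed v = proj₂ (proj₂ (proj₂ (placement v)))

    same-index : ∀ i {ε ε′} → ε ≢ ε′ → Apart i ε i ε′ ⊎ Apart i ε′ i ε
    same-index i {false} {true} _ = inj₁ (separated-antipodal i)
    same-index i {true} {false} _ = inj₂ (separated-antipodal i)
    same-index i {false} {false} ε≢ε′ = contradiction refl ε≢ε′
    same-index i {true} {true} ε≢ε′ = contradiction refl ε≢ε′

    separated : ∀ i {ε} i′ {ε′} → (i ≡ i′ → ε ≢ ε′) → Apart i ε i′ ε′ ⊎ Apart i′ ε′ i ε
    separated i {ε} i′ {ε′} distinct with <-cmp i i′
    ... | tri< i<i′ _ _ = inj₁ (separated-< ε ε′ i<i′)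
    ... | tri> _ _ i′<i = inj₂ (separated-< ε′ ε i′<i)
    ... | tri≈ _ refl _ = same-index i (distinct refl)

    -- A position determines its vertex modulo n, so the choice of index and side is injective.
    placed-distinct : ∀ {u v : Fin n} {i ε i′ ε′} → u ≢ v →
      Cong n (toℕ u) (position i ε) → Cong n (toℕ v) (position i′ ε′) → i ≡ i′ → ε ≢ ε′
    placed-distinct u≢v cu cv refl refl = u≢v (Cong-unique cu cv)

  labeling-radio : IsRadioLabeling n (2 * h + 2 * t + 1) labeling
  labeling-radio u v u≢v d (walk , _) = subst (_≤ ∣ labeling u - labeling v ∣ + d)
    (sym (+-assoc (2 * h + 2 * t) 1 1))
    (by-order (separated (index u) (index v) (placed-distinct u≢v (placed u) (placed v))))
    where
    by-order : Apart (index u) (side u) (index v) (side v)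
             ⊎ Apart (index v) (side v) (index u) (side u) →
      K ≤ ∣ labeling u - labeling v ∣ + d
    by-order (inj₁ sep) = separated⇒radio (placed u) (placed v) sep walk
    by-order (inj₂ sep) = subst (λ z → K ≤ z + d) (∣-∣-comm (labeling v) (labeling u))
      (separated⇒radio (placed v) (placed u) sep (reverseʷ walk))

  -- The largest index is m - 1 = 2h + t. The strict inequality comes from i < M q, which makes
  -- ⌊i/M⌋ at most q - 1.
  labeling-bound : ∀ v → labeling v < (2 * h + t) * φ + g + q
  labeling-bound v = begin-strict
    label i ε                          ≤⟨ +-monoʳ-≤ (i * φ + i / M) (half≤ ε g) ⟩
    i * φ + i / M + g                  <⟨ +-monoˡ-< g (+-mono-≤-< (*-monoˡ-≤ φ i≤) i/M<q) ⟩
    (2 * h + t) * φ + q + g            ≡⟨ +-assoc ((2 * h + t) * φ) q g ⟩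
    (2 * h + t) * φ + (q + g)          ≡⟨ cong ((2 * h + t) * φ +_) (+-comm q g) ⟩
    (2 * h + t) * φ + (g + q)          ≡⟨ +-assoc ((2 * h + t) * φ) g q ⟨
    (2 * h + t) * φ + g + q            ∎
    where
    open ≤-Reasoning
    i : ℕ
    i = index v
    ε : Bool
    ε = side v
    i<m : i < m
    i<m = proj₁ (proj₂ (placement v))
    i≤ : i ≤ 2 * h + t
    i≤ = ≤-pred (subst (i <_) (+-comm (2 * h + t) 1) i<m)
    i/M<q : i / M < q
    i/M<q = m<n*o⇒m/o<n (subst (i <_) (trans m≡Mq (*-comm M q)) i<m)

  labeling-span : ∃[ s ] IsSpan n labeling s × s < (2 * h + t) * φ + g + q
  labeling-span = bounded⇒span {{≢-nonZero (m+1+n≢0 (4 * h + 2 * t))}} labeling labeling-bound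

-- The two greatest common divisors and the resulting bounds

gcd-nonZero : ∀ a b .{{_ : NonZero b}} → NonZero (gcd a b)
gcd-nonZero a b = ≢-nonZero (gcd[m,n]≢0 a b (inj₂ (≢-nonZero⁻¹ b)))

-- `M` is the order of h in ℤ_m. The multiples i h return to 0 after `M` steps, and ⌊i/M⌋ then
-- shifts to the next of the gcd(h, m) cosets of ⟨h⟩.
slots : ∀ h m .{{_ : NonZero h}} .{{_ : NonZero m}} →
  ∃[ M ] Σ[ M≢0 ∈ NonZero M ] m ≡ M * gcd h m
    × (∀ v → ∃[ i ] i < m × Cong m (i * h + _/_ i M {{M≢0}}) v)
slots h m with gcd[m,n]∣n h m | gcd[m,n]∣m h m | bézout h m
... | divides M m≡Mq | divides η h≡ηq | s , c , sh = M , M≢0 , m≡Mq ,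
  subst₂ (λ h m → ∀ v → ∃[ i ] i < m × Cong m (i * h + _/_ i M {{M≢0}}) v) (sym h≡ηq) (sym m≡Mq)
    (slot-exists {gcd h m} {M} {η} {{gcd-nonZero h m}} {{M≢0}} s c
      (subst₂ (λ x y → s * x ≡ gcd h m + c * y) h≡ηq m≡Mq sh))
  where
  M≢0 : NonZero M
  M≢0 = ≢-nonZero λ M≡0 → ≢-nonZero⁻¹ m (trans m≡Mq (cong (_* gcd h m) M≡0))

module _ (h t : ℕ) .{{h≢0 : NonZero h}} where
  private
    n m k L : ℕ
    n = 4 * h + 2 * t + 2
    m = 2 * h + t + 1
    k = 2 * h + 2 * t + 1
    L = (2 * h + t) * (h + 2 * t + 2) + (t + 1)

  -- Here and in `radio-number-upper`, `suc r` carries the -1 of the theorem without subtraction.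
  radio-number-lower : ∀ {r} → IsRadioNumber n k r → L + ⌈ gcd n h /2⌉ ≤ suc r
  radio-number-lower {r} ((f , radio , spread , _) , _) = LowerBound.span-bound h t (gcd n h)
    {{gcd-nonZero n h}} (gcd[m,n]∣m n h) (gcd[m,n]∣n n h) f radio r spread

  half-nonZero : NonZero m
  half-nonZero = ≢-nonZero (m+1+n≢0 (2 * h + t))

  order-nonZero : NonZero n
  order-nonZero = ≢-nonZero (m+1+n≢0 (4 * h + 2 * t))

  radio-number-upper : ∀ {r} → IsRadioNumber n k r → suc r ≤ L + gcd h m
  radio-number-upper (_ , minimal) =
    let M , M≢0 , m≡Mq , slot = slots h m {{h≢0}} {{half-nonZero}}
        open UpperBound h t (gcd h m) M {{M≢0}} m≡Mq slot
        s , span , s<L+q = labeling-span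
    in ≤-<-trans (minimal labeling s labeling-radio span) s<L+q

  n≡2*m : n ≡ 2 * m
  n≡2*m = sym (double-half h t)

  gcd-half∣gcd : gcd h m ∣ gcd n h
  gcd-half∣gcd = gcd-greatest
    (subst (gcd h m ∣_) (sym n≡2*m) (∣-trans (gcd[m,n]∣n h m) (n∣m*n 2))) (gcd[m,n]∣m h m)

  gcd-half≤gcd : gcd h m ≤ gcd n h
  gcd-half≤gcd = ∣⇒≤ {{gcd-nonZero n h}} gcd-half∣gcd

  -- Bézout makes the gcd a multiple of h modulo n; scaling by `e`, the quotient of m by the gcd,
  -- reaches m.
  gcd∣half⇒∈⟨h⟩ : gcd n h ∣ m → InCyclicSubgroup n h m
  gcd∣half⇒∈⟨h⟩ (divides e m≡ep) with bézout h n {{h≢0}} {{order-nonZero}}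
  ... | s , c , sh = e * s , e * c , (begin
    e * s * h                    ≡⟨ subgroup-multiple {e} {s} {h} {gcd h n} {c} {n} sh ⟩
    e * gcd h n + e * c * n      ≡⟨ cong (λ p → e * p + e * c * n) (gcd-comm h n) ⟩
    e * gcd n h + e * c * n      ≡⟨ cong (_+ e * c * n) m≡ep ⟨
    m + e * c * n                ∎)
    where open ≡-Reasoning

  -- A proper divisor is at most half.
  gcd-half≤⌈gcd/2⌉ : ¬ InCyclicSubgroup n h m → gcd h m ≤ ⌈ gcd n h /2⌉
  gcd-half≤⌈gcd/2⌉ m∉⟨h⟩ with gcd-half∣gcd
  ... | divides zero p≡0 = contradiction p≡0 (gcd[m,n]≢0 n h (inj₂ (≢-nonZero⁻¹ h)))
  ... | divides (suc zero) p≡q = contradiction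
    (gcd∣half⇒∈⟨h⟩ (subst (_∣ m) (sym (trans p≡q (+-identityʳ _))) (gcd[m,n]∣n h m))) m∉⟨h⟩
  ... | divides (suc (suc y)) p≡ = begin
    q                  ≡⟨ n≡⌈n+n/2⌉ q ⟩
    ⌈ q + q /2⌉        ≤⟨ ⌈n/2⌉-mono (+-monoʳ-≤ q (m≤m+n q (y * q))) ⟩
    ⌈ q + (q + y * q) /2⌉   ≡⟨ cong ⌈_/2⌉ p≡ ⟨
    ⌈ gcd n h /2⌉      ∎
    where
    open ≤-Reasoning
    q : ℕ
    q = gcd h m

  n/2≡ : n / 2 ≡ m
  n/2≡ = trans (/-congˡ (n-as-half h t)) (m*n/n≡m m 2)

  h≡ : (n ∸ k ∸ 1) / 2 ≡ h
  h≡ = begin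
    (n ∸ k ∸ 1) / 2                   ≡⟨ cong (λ z → (z ∸ k ∸ 1) / 2) (n-over-k h t) ⟩
    (h * 2 + 1 + k ∸ k ∸ 1) / 2       ≡⟨ cong (λ z → (z ∸ 1) / 2) (m+n∸n≡m (h * 2 + 1) k) ⟩
    (h * 2 + 1 ∸ 1) / 2               ≡⟨ /-congˡ (m+n∸n≡m (h * 2) 1) ⟩
    h * 2 / 2                         ≡⟨ m*n/n≡m h 2 ⟩
    h                                 ∎
    where open ≡-Reasoning

  -- 3k + 3 - n is φ + φ, so the ceiling in `LB` is exact.
  LB≡ : LB n k ≡ L
  LB≡ = begin
    ⌈ (3 * k + 3 ∸ n) /2⌉ * ((n ∸ 2) / 2) + (k ∸ n / 2) + 1
      ≡⟨ cong₂ (λ x y → ⌈ x /2⌉ * y + (k ∸ n / 2) + 1) triple half-order ⟩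
    ⌈ φ + φ /2⌉ * (2 * h + t) + (k ∸ n / 2) + 1
      ≡⟨ cong₂ (λ x y → x * (2 * h + t) + y + 1) (sym (n≡⌈n+n/2⌉ φ)) slack ⟩
    φ * (2 * h + t) + t + 1
      ≡⟨ cong (λ x → x + t + 1) (*-comm φ (2 * h + t)) ⟩
    (2 * h + t) * φ + t + 1
      ≡⟨ +-assoc _ t 1 ⟩
    L ∎
    where
    open ≡-Reasoning
    φ : ℕ
    φ = h + 2 * t + 2
    triple : 3 * k + 3 ∸ n ≡ φ + φ
    triple = trans (cong (_∸ n) (triple-k h t)) (m+n∸n≡m (φ + φ) n)
    half-order : (n ∸ 2) / 2 ≡ 2 * h + t
    half-order = trans (/-congˡ (trans (cong (_∸ 2) (n-as-order h t)) (m+n∸n≡m ((2 * h + t) * 2) 2)))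
      (m*n/n≡m (2 * h + t) 2)
    slack : k ∸ n / 2 ≡ t
    slack = trans (cong₂ _∸_ (k-over-half h t) n/2≡) (m+n∸n≡m t m)

  radio-number-bounds : ∀ {r} → IsRadioNumber n k r →
    (L + ⌈ gcd n h /2⌉ ∸ 1 ≤ r × r ≤ L + gcd n h ∸ 1)
    × (¬ InCyclicSubgroup n h m → r ≡ L + ⌈ gcd n h /2⌉ ∸ 1)
  radio-number-bounds {r} rn =
    (lower , ∸-monoˡ-≤ 1 (≤-trans (radio-number-upper rn) (+-monoʳ-≤ L gcd-half≤gcd))) ,
    λ m∉⟨h⟩ → ≤-antisym
      (∸-monoˡ-≤ 1 (≤-trans (radio-number-upper rn) (+-monoʳ-≤ L (gcd-half≤⌈gcd/2⌉ m∉⟨h⟩)))) lower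
    where
    lower : L + ⌈ gcd n h /2⌉ ∸ 1 ≤ r
    lower = m≤n+o⇒m∸n≤o _ 1 (radio-number-lower rn)

-- Parametrization of n and k by h and t

%2⇒*2 : ∀ {n b} → n % 2 ≡ b → n ≡ b + n / 2 * 2
%2⇒*2 {n} n%2≡b = trans (m≡m%n+[m/n]*n n 2) (cong (_+ n / 2 * 2) n%2≡b)

-- Let j = (k - 1)/2 and m = n/2. Then k < n - 3 reads j + 2 < m, so h = m - j - 1 is at least 2 and
-- appears as `suc (suc o)`. The hypothesis m ≤ k reads h ≤ j, and t = j - h.
parameters : ∀ n k → n % 2 ≡ 0 → k % 2 ≡ 1 → n / 2 ≤ k → k < n ∸ 3 →
  ∃[ h ] ∃[ t ] NonZero h × n ≡ 4 * h + 2 * t + 2 × k ≡ 2 * h + 2 * t + 1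
parameters n k n-even k-odd m≤k k<n∸3
  with m≤n⇒∃[o]m+o≡n (*-cancelʳ-< 2 (k / 2 + 2) (n / 2) (k<n-3⇒j+2<m {k / 2} {n / 2}
         (subst₂ (λ k n → k + 3 < n) (%2⇒*2 k-odd) (%2⇒*2 n-even) k+3<n)))
  where
  k+3<n : k + 3 < n
  k+3<n = ≰⇒> λ n≤k+3 → <⇒≱ k<n∸3 (m≤n+o⇒m∸n≤o n 3 (subst (n ≤_) (+-comm k 3) n≤k+3))
... | o , j+2+o≡m
  with m≤n⇒∃[o]m+o≡n (m≤k⇒h≤j {k / 2} {suc (suc o)}
         (subst₂ _≤_ (trans (sym j+2+o≡m) (excess-shift (k / 2) o)) (%2⇒*2 k-odd) m≤k))
... | t , h+t≡j = suc (suc o) , t , _ ,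
  trans (%2⇒*2 n-even) (n-from-h-t (suc (suc o)) t
    (trans (sym j+2+o≡m) (excess-shift (k / 2) o)) (sym h+t≡j)) ,
  trans (%2⇒*2 k-odd) (k-from-h-t (suc (suc o)) t (sym h+t≡j))

theorem4p3 : ∀ (n k r : ℕ) → n % 2 ≡ 0 → k % 2 ≡ 1 → n / 2 ≤ k → k < n ∸ 3 →
    IsRadioNumber n k r →
    (LB n k + ⌈ gcd n ((n ∸ k ∸ 1) / 2) /2⌉ ∸ 1 ≤ r
    × r ≤ LB n k + gcd n ((n ∸ k ∸ 1) / 2) ∸ 1)
    × (¬ InCyclicSubgroup n ((n ∸ k ∸ 1) / 2) (n / 2) →
    r ≡ LB n k + ⌈ gcd n ((n ∸ k ∸ 1) / 2) /2⌉ ∸ 1)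
theorem4p3 n k r n-even k-odd m≤k k<n∸3 rn with parameters n k n-even k-odd m≤k k<n∸3
... | h , t , h≢0 , refl , refl
  rewrite LB≡ h t {{h≢0}} | h≡ h t {{h≢0}} | n/2≡ h t {{h≢0}} =
  radio-number-bounds h t {{h≢0}} rn
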